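{- Let $\langle\mathcal{C},\mathcal{P}\rangle$ be a satisfiable probabilistic knowledge base over $\mathcal{EL}^{++}$, $C\sqsubseteq D$ an axiom, and $\varepsilon>0$. Let $\overline{p}=\sup\{P(C\sqsubseteq D)\}$ over all satisfying probability distributions of $\langle\mathcal{C},\mathcal{P}\rangle$ (the maximum extension value), and similarly $\underline{p}$ the infimum. Then values within $\varepsilon$ of $\overline{p}$ and of $\underline{p}$ can be computed by a procedure that makes $O(|\log\varepsilon|)$ calls to a decision procedure for probabilistic knowledge base satisfiability (each call on $\langle\mathcal{C},\mathcal{P}\cup\{\gamma\}\rangle$ for a single added constraint $\gamma$ of the form $P(C\sqsubseteq D)\bowtie v$ with rational $v$), plus polynomial additional work.
   Context: $\mathcal{EL}^{++}$ (without concrete domains): over countable sets $\mathsf{N_C}$ (concept names), $\mathsf{N_R}$ (role names), $\mathsf{N_I}$ (individual names), concept descriptions are $\top,\bot$, concept names, $C\sqcap D$, $\exists r.C$ ($r\in\mathsf{N_R}$) and nominals $\{a\}$ ($a\in\mathsf{N_I}$). An axiom (GCI) is $C\sqsubseteq D$; a role inclusion is $r_1\circ\cdots\circ r_k\sqsubseteq r$; a CBox is a finite set of axioms and role inclusions. An interpretation $\mathcal{I}=\langle\Delta^\mathcal{I},\cdot^\mathcal{I}\rangle$ has nonempty domain and maps concept names to subsets, role names to binary relations, individuals to elements, with $\top^\mathcal{I}=\Delta^\mathcal{I}$, $\bot^\mathcal{I}=\emptyset$, $(C\sqcap D)^\mathcal{I}=C^\mathcal{I}\cap D^\mathcal{I}$,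 $(\exists r.C)^\mathcal{I}=\{x\mid \exists y\in C^\mathcal{I},(x,y)\in r^\mathcal{I}\}$, $\{a\}^\mathcal{I}=\{a^\mathcal{I}\}$; $\mathcal{I}\models C\sqsubseteq D$ iff $C^\mathcal{I}\subseteq D^\mathcal{I}$, $\mathcal{I}\models r_1\circ\cdots\circ r_k\sqsubseteq r$ iff $r_1^\mathcal{I}\circ\cdots\circ r_k^\mathcal{I}\subseteq r^\mathcal{I}$, and $\mathcal{I}\models\mathcal{C}$ iff it satisfies every element of $\mathcal{C}$. Probabilistic semantics: given finitely many interpretations $\mathcal{I}_1,\dots,\mathcal{I}_m$ and a probability distribution $P$ on them, $P(C\sqsubseteq D)=\sum_{\mathcal{I}_i\models C\sqsubseteq D}P(\mathcal{I}_i)$. A probabilistic constraint is $b_1 P(C_1\sqsubseteq D_1)+\cdots+b_\ell P(C_\ell\sqsubseteq D_\ell)\bowtie q$ with $b_i,q\in\mathbb{Q}$, $\bowtie\in\{\le,\ge,=\}$; a PBox is a finite set of such constraints; a probabilistic knowledge base is a pair $\langle\mathcal{C},\mathcal{P}\rangle$ of a CBox and a PBox. It is satisfiable if there exist finitely many interpretations and a probability distribution $P$ over them such that every interpretation with $P(\mathcal{I}_i)>0$ satisfies $\mathcal{C}$ and all constraints of $\mathcal{P}$ hold. A satisfying probability distribution is any such $P$. -}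

module Defs where

open import Axiom.ExcludedMiddle using (ExcludedMiddle)
open import Data.Bool.Base using (Bool; if_then_else_)
open import Data.Empty using (⊥)
open import Data.Fin.Base using (Fin)
open import Data.Integer.Base as ℤ using (+_)
open import Data.List.Base using (List; []; _∷_; map)
open import Data.List.NonEmpty.Base
  using (List⁺; toList; foldr₁) renaming (map to map⁺; _∷_ to _∷₁_)
open import Data.List.Relation.Unary.All using (All)
open import Data.Nat.Base as ℕ using (ℕ; zero; suc; _^_)
open import Data.Nat.ListAction using (sum)
open import Data.Nat.Logarithm using (⌊log₂_⌋)
import Data.Nat.Properties as ℕₚ
open import Data.Product.Base using (_×_; _,_; ∃-syntax; Σ-syntax)
open import Data.Rational.Base as ℚ
  using (ℚ; 0ℚ; 1ℚ; ½; ↥_; ↧ₙ_; Positive; NonNegative; positive; nonNegative)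
import Data.Rational.Properties as ℚₚ
open import Data.Sum.Base using (_⊎_)
open import Data.Unit.Base using (⊤)
import Data.Vec.Functional as Vector
open import Function.Bundles using (_↣_; module Injection)
open import Level using (0ℓ)
open import Relation.Binary.PropositionalEquality
  using (_≡_; sym; trans; cong; subst; module ≡-Reasoning)
open import Relation.Nullary.Decidable.Core using (does)
open import Relation.Nullary.Negation.Core using (¬_)
open import Relation.Unary using (Decidable)

-- Real numbers: Cauchy sequences of rationals, compared up to _≈ᴿ_.

record ℝ : Set where
  constructor mkℝ
  field
    seq    : ℕ → ℚ
    cauchy : ∀ ε → 0ℚ ℚ.< ε →
             ∃[ N ] (∀ m n → N ℕ.≤ m → N ℕ.≤ n → ℚ.∣ seq m ℚ.- seq n ∣ ℚ.≤ ε)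

open ℝ public

infix  4 _≤ᴿ_ _<ᴿ_ _≈ᴿ_
infixl 6 _+ᴿ_
infixl 7 _·ᴿ_

_≤ᴿ_ : ℝ → ℝ → Set
x ≤ᴿ y = ∀ ε → 0ℚ ℚ.< ε → ∃[ N ] (∀ n → N ℕ.≤ n → seq x n ℚ.≤ seq y n ℚ.+ ε)

_≈ᴿ_ : ℝ → ℝ → Set
x ≈ᴿ y = x ≤ᴿ y × y ≤ᴿ x

fromℚ : ℚ → ℝ
fromℚ q = mkℝ (λ _ → q) λ ε 0<ε → 0 , λ _ _ _ _ →
  subst (ℚ._≤ ε) (sym (cong ℚ.∣_∣ (ℚₚ.+-inverseʳ q))) (ℚₚ.<⇒≤ 0<ε)

private
  half-pos : ∀ {ε} → 0ℚ ℚ.< ε → 0ℚ ℚ.< ½ ℚ.* ε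
  half-pos {ε} 0<ε =
    ℚₚ.positive⁻¹ (½ ℚ.* ε) {{ℚₚ.pos*pos⇒pos ½ ε {{positive 0<ε}}}}

  half+half : ∀ ε → ½ ℚ.* ε ℚ.+ ½ ℚ.* ε ≡ ε
  half+half ε = trans (sym (ℚₚ.*-distribʳ-+ ε ½ ½)) (ℚₚ.*-identityˡ ε)

  interchange : ∀ a b c d → (a ℚ.+ b) ℚ.+ (c ℚ.+ d) ≡ (a ℚ.+ c) ℚ.+ (b ℚ.+ d)
  interchange a b c d = begin
    (a ℚ.+ b) ℚ.+ (c ℚ.+ d) ≡⟨ ℚₚ.+-assoc a b (c ℚ.+ d) ⟩
    a ℚ.+ (b ℚ.+ (c ℚ.+ d)) ≡⟨ cong (a ℚ.+_) (sym (ℚₚ.+-assoc b c d)) ⟩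
    a ℚ.+ ((b ℚ.+ c) ℚ.+ d) ≡⟨ cong (λ z → a ℚ.+ (z ℚ.+ d)) (ℚₚ.+-comm b c) ⟩
    a ℚ.+ ((c ℚ.+ b) ℚ.+ d) ≡⟨ cong (a ℚ.+_) (ℚₚ.+-assoc c b d) ⟩
    a ℚ.+ (c ℚ.+ (b ℚ.+ d)) ≡⟨ sym (ℚₚ.+-assoc a c (b ℚ.+ d)) ⟩
    (a ℚ.+ c) ℚ.+ (b ℚ.+ d) ∎
    where open ≡-Reasoning

  regroup : ∀ a b c d → (a ℚ.+ b) ℚ.- (c ℚ.+ d) ≡ (a ℚ.- c) ℚ.+ (b ℚ.- d)
  regroup a b c d =
    trans (cong ((a ℚ.+ b) ℚ.+_) (ℚₚ.neg-distrib-+ c d))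
          (interchange a b (ℚ.- c) (ℚ.- d))

  factor : ∀ q a b → q ℚ.* a ℚ.- q ℚ.* b ≡ q ℚ.* (a ℚ.- b)
  factor q a b =
    trans (cong (q ℚ.* a ℚ.+_) (ℚₚ.neg-distribʳ-* q b))
          (sym (ℚₚ.*-distribˡ-+ q a (ℚ.- b)))

  ≤1+ : ∀ p → p ℚ.≤ 1ℚ ℚ.+ p
  ≤1+ p = subst (ℚ._≤ 1ℚ ℚ.+ p) (ℚₚ.+-identityˡ p)
    (ℚₚ.+-monoˡ-≤ p (ℚₚ.nonNegative⁻¹ 1ℚ))

_+ᴿ_ : ℝ → ℝ → ℝ
x +ᴿ y = mkℝ (λ n → seq x n ℚ.+ seq y n) λ ε 0<ε →
  let (M , p) = cauchy x (½ ℚ.* ε) (half-pos 0<ε)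
      (N , q) = cauchy y (½ ℚ.* ε) (half-pos 0<ε)
  in M ℕ.⊔ N , λ m n m≥ n≥ → begin
    ℚ.∣ (seq x m ℚ.+ seq y m) ℚ.- (seq x n ℚ.+ seq y n) ∣
      ≡⟨ cong ℚ.∣_∣ (regroup (seq x m) (seq y m) (seq x n) (seq y n)) ⟩
    ℚ.∣ (seq x m ℚ.- seq x n) ℚ.+ (seq y m ℚ.- seq y n) ∣
      ≤⟨ ℚₚ.∣p+q∣≤∣p∣+∣q∣ (seq x m ℚ.- seq x n) (seq y m ℚ.- seq y n) ⟩
    ℚ.∣ seq x m ℚ.- seq x n ∣ ℚ.+ ℚ.∣ seq y m ℚ.- seq y n ∣
      ≤⟨ ℚₚ.+-mono-≤ (p m n (ℕₚ.m⊔n≤o⇒m≤o M N m≥) (ℕₚ.m⊔n≤o⇒m≤o M N n≥))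
                     (q m n (ℕₚ.m⊔n≤o⇒n≤o M N m≥) (ℕₚ.m⊔n≤o⇒n≤o M N n≥)) ⟩
    ½ ℚ.* ε ℚ.+ ½ ℚ.* ε
      ≡⟨ half+half ε ⟩
    ε ∎
  where open ℚₚ.≤-Reasoning

private
  -- a modulus for scaling by q
  shrink : ∀ q ε → 0ℚ ℚ.< ε → ∃[ δ ] (0ℚ ℚ.< δ × ℚ.∣ q ∣ ℚ.* δ ℚ.≤ ε)
  shrink q ε 0<ε = go ℚ.∣ q ∣ (ℚₚ.∣-∣-nonNeg q)
    where
    go : ∀ r → NonNegative r → ∃[ δ ] (0ℚ ℚ.< δ × r ℚ.* δ ℚ.≤ ε)
    go r r≥0 = scaled (1ℚ ℚ.+ r) (ℚₚ.pos+nonNeg⇒pos 1ℚ r {{r≥0}}) (≤1+ r)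
      where
      scaled : ∀ s → Positive s → r ℚ.≤ s → ∃[ δ ] (0ℚ ℚ.< δ × r ℚ.* δ ℚ.≤ ε)
      scaled s s>0 r≤s = δ , ℚₚ.positive⁻¹ δ {{δ>0}} , r*δ≤ε
        where
        instance
          s≢0 : ℚ.NonZero s
          s≢0 = ℚₚ.pos⇒nonZero s {{s>0}}
        δ = ℚ.1/ s ℚ.* ε
        δ>0 : Positive δ
        δ>0 = ℚₚ.pos*pos⇒pos (ℚ.1/ s) {{ℚₚ.1/pos⇒pos s {{s>0}}}} ε {{positive 0<ε}}
        s*δ≡ε : s ℚ.* δ ≡ ε
        s*δ≡ε = trans (sym (ℚₚ.*-assoc s (ℚ.1/ s) ε))
               (trans (cong (ℚ._* ε) (ℚₚ.*-inverseʳ s)) (ℚₚ.*-identityˡ ε))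
        r*δ≤ε : r ℚ.* δ ℚ.≤ ε
        r*δ≤ε = subst (r ℚ.* δ ℚ.≤_) s*δ≡ε
          (ℚₚ.*-monoʳ-≤-nonNeg δ {{ℚₚ.pos⇒nonNeg δ {{δ>0}}}} r≤s)

_·ᴿ_ : ℚ → ℝ → ℝ
q ·ᴿ x = mkℝ (λ n → q ℚ.* seq x n) λ ε 0<ε →
  let (δ , 0<δ , qδ≤ε) = shrink q ε 0<ε
      (N , p) = cauchy x δ 0<δ
  in N , λ m n m≥ n≥ → begin
    ℚ.∣ q ℚ.* seq x m ℚ.- q ℚ.* seq x n ∣
      ≡⟨ cong ℚ.∣_∣ (factor q (seq x m) (seq x n)) ⟩
    ℚ.∣ q ℚ.* (seq x m ℚ.- seq x n) ∣
      ≡⟨ ℚₚ.∣p*q∣≡∣p∣*∣q∣ q (seq x m ℚ.- seq x n) ⟩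
    ℚ.∣ q ∣ ℚ.* ℚ.∣ seq x m ℚ.- seq x n ∣
      ≤⟨ ℚₚ.*-monoˡ-≤-nonNeg ℚ.∣ q ∣ {{ℚₚ.∣-∣-nonNeg q}} (p m n m≥ n≥) ⟩
    ℚ.∣ q ∣ ℚ.* δ
      ≤⟨ qδ≤ε ⟩
    ε ∎
  where open ℚₚ.≤-Reasoning

_<ᴿ_ : ℝ → ℝ → Set
x <ᴿ y = ∃[ ε ] (0ℚ ℚ.< ε × x +ᴿ fromℚ ε ≤ᴿ y)

0ᴿ 1ᴿ : ℝ
0ᴿ = fromℚ 0ℚ
1ᴿ = fromℚ 1ℚ

∑ᴿ : ∀ {m} → (Fin m → ℝ) → ℝ
∑ᴿ = Vector.foldr _+ᴿ_ 0ᴿ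

IsSupremum IsInfimum : ∀ {ℓ} → (ℝ → Set ℓ) → ℝ → Set ℓ
IsSupremum A s = (∀ x → A x → x ≤ᴿ s) × (∀ u → (∀ x → A x → x ≤ᴿ u) → s ≤ᴿ u)
IsInfimum  A i = (∀ x → A x → i ≤ᴿ x) × (∀ l → (∀ x → A x → l ≤ᴿ x) → l ≤ᴿ i)

-- ∣ v - x ∣ ≤ ε
Within : ℚ → ℚ → ℝ → Set
Within ε v x = fromℚ (v ℚ.- ε) ≤ᴿ x × x ≤ᴿ fromℚ (v ℚ.+ ε)

-- n ≤ c · ∣log₂ ε∣ for ε > 0: the two disjuncts are 2ⁿ ≤ εᶜ and 2ⁿ ≤ ε⁻ᶜ,
-- cleared of denominators.
_≤_∣log₂_∣ : ℕ → ℕ → ℚ → Set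
n ≤ c ∣log₂ ε ∣ =
  (2 ^ n ℕ.* den ^ c ℕ.≤ num ^ c) ⊎ (2 ^ n ℕ.* num ^ c ℕ.≤ den ^ c)
  where
  num = ℤ.∣ ↥ ε ∣
  den = ↧ₙ ε

-- length of the binary representation
bits : ℕ → ℕ
bits n = suc ⌊log₂ n ⌋

sizeℚ : ℚ → ℕ
sizeℚ q = bits ℤ.∣ ↥ q ∣ ℕ.+ bits (↧ₙ q)

-- Countable sets of names; the codes also fix the length of a written name.
record Signature : Set₁ where
  field
    N-C N-R N-I : Set
    codeC : N-C ↣ ℕ
    codeR : N-R ↣ ℕ
    codeI : N-I ↣ ℕ

data Comparison : Set where
  le ge eq : Comparison

module Syntax (S : Signature) where
  open Signature S

  infixr 7 _⊓_
  infix  5 _⊑_ _⊑ʳ_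

  data Concept : Set where
    ⊤ᶜ ⊥ᶜ   : Concept
    atom    : N-C → Concept
    _⊓_     : Concept → Concept → Concept
    ∃ᶜ      : N-R → Concept → Concept
    nominal : N-I → Concept

  data Axiom : Set where
    _⊑_ : Concept → Concept → Axiom

  -- r₁ ∘ ⋯ ∘ rₖ ⊑ r with k ≥ 1
  data RoleInclusion : Set where
    _⊑ʳ_ : List⁺ N-R → N-R → RoleInclusion

  data CBoxItem : Set where
    gci : Axiom → CBoxItem
    ri  : RoleInclusion → CBoxItem

  CBox : Set
  CBox = List CBoxItem

  record Constraint : Set where
    constructor constraint
    field
      terms      : List⁺ (ℚ × Axiom)
      comparison : Comparison
      bound      : ℚ

  PBox : Set
  PBox = List Constraint

  record KB : Set where
    constructor ⟨_,_⟩
    field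
      cbox : CBox
      pbox : PBox

  singleConstraint : Axiom → Comparison → ℚ → Constraint
  singleConstraint α ⋈ v = constraint ((1ℚ , α) ∷₁ []) ⋈ v

  addConstraint : KB → Constraint → KB
  addConstraint ⟨ C , P ⟩ γ = ⟨ C , γ ∷ P ⟩

  sizeC : Concept → ℕ
  sizeC ⊤ᶜ          = 1
  sizeC ⊥ᶜ          = 1
  sizeC (atom A)    = suc (bits (Injection.to codeC A))
  sizeC (C ⊓ D)     = suc (sizeC C ℕ.+ sizeC D)
  sizeC (∃ᶜ r C)    = suc (bits (Injection.to codeR r) ℕ.+ sizeC C)
  sizeC (nominal a) = suc (bits (Injection.to codeI a))

  sizeA : Axiom → ℕ
  sizeA (C ⊑ D) = suc (sizeC C ℕ.+ sizeC D)

  sizeRI : RoleInclusion → ℕ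
  sizeRI (rs ⊑ʳ r) =
    suc (sum (map (λ s → bits (Injection.to codeR s)) (toList rs))
         ℕ.+ bits (Injection.to codeR r))

  sizeItem : CBoxItem → ℕ
  sizeItem (gci α) = suc (sizeA α)
  sizeItem (ri ρ)  = suc (sizeRI ρ)

  sizeConstraint : Constraint → ℕ
  sizeConstraint (constraint ts _ q) =
    suc (sum (map (λ (b , α) → sizeℚ b ℕ.+ sizeA α) (toList ts)) ℕ.+ sizeℚ q)

  sizeKB : KB → ℕ
  sizeKB ⟨ C , P ⟩ = suc (sum (map sizeItem C) ℕ.+ sum (map sizeConstraint P))

-- Excluded middle decides which interpretations count towards P(C ⊑ D):
-- ℐ ⊨ C ⊑ D is undecidable in general, as domains may be infinite.
module Semantics (S : Signature) (em : ExcludedMiddle 0ℓ) where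
  open Signature S
  open Syntax S

  record Interpretation : Set₁ where
    field
      Δ        : Set
      nonempty : Δ
      ⟦_⟧C     : N-C → Δ → Set
      ⟦_⟧R     : N-R → Δ → Δ → Set
      ⟦_⟧I     : N-I → Δ

    ⟦_⟧ : Concept → Δ → Set
    ⟦ ⊤ᶜ ⟧        x = ⊤
    ⟦ ⊥ᶜ ⟧        x = ⊥
    ⟦ atom A ⟧    x = ⟦ A ⟧C x
    ⟦ C ⊓ D ⟧     x = ⟦ C ⟧ x × ⟦ D ⟧ x
    ⟦ ∃ᶜ r C ⟧    x = ∃[ y ] (⟦ C ⟧ y × ⟦ r ⟧R x y)
    ⟦ nominal a ⟧ x = x ≡ ⟦ a ⟧I

    compose : (Δ → Δ → Set) → (Δ → Δ → Set) → Δ → Δ → Set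
    compose R T x z = ∃[ y ] (R x y × T y z)

    chain : List⁺ N-R → Δ → Δ → Set
    chain rs = foldr₁ compose (map⁺ ⟦_⟧R rs)

  open Interpretation

  _⊨_ : Interpretation → Axiom → Set
  ℐ ⊨ (C ⊑ D) = ∀ x → ⟦ ℐ ⟧ C x → ⟦ ℐ ⟧ D x

  _⊨ʳ_ : Interpretation → RoleInclusion → Set
  ℐ ⊨ʳ (rs ⊑ʳ r) = ∀ x y → chain ℐ rs x y → ⟦ ℐ ⟧R r x y

  _⊨ⁱ_ : Interpretation → CBoxItem → Set
  ℐ ⊨ⁱ gci α = ℐ ⊨ α
  ℐ ⊨ⁱ ri ρ  = ℐ ⊨ʳ ρ

  _⊨ᶜ_ : Interpretation → CBox → Set
  ℐ ⊨ᶜ C = All (ℐ ⊨ⁱ_) C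

  record Distribution : Set₁ where
    field
      m      : ℕ
      interp : Fin m → Interpretation
      weight : Fin m → ℝ
      nonneg : ∀ i → 0ᴿ ≤ᴿ weight i
      total  : ∑ᴿ weight ≈ᴿ 1ᴿ

    prob : Axiom → ℝ
    prob α = ∑ᴿ (λ i → if does (em {interp i ⊨ α}) then weight i else 0ᴿ)

  open Distribution

  compare : Comparison → ℝ → ℝ → Set
  compare le x y = x ≤ᴿ y
  compare ge x y = y ≤ᴿ x
  compare eq x y = x ≈ᴿ y

  _⊨ᵖ_ : Distribution → Constraint → Set
  P ⊨ᵖ constraint ts ⋈ q =
    compare ⋈ (foldr₁ _+ᴿ_ (map⁺ (λ (b , α) → b ·ᴿ prob P α) ts)) (fromℚ q)

  record _Satisfies_ (P : Distribution) (K : KB) : Set where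
    open KB K
    field
      sat-cbox : ∀ i → 0ᴿ <ᴿ weight P i → interp P i ⊨ᶜ cbox
      sat-pbox : All (P ⊨ᵖ_) pbox

  Satisfiable : KB → Set₁
  Satisfiable K = Σ[ P ∈ Distribution ] P Satisfies K

  -- { P(C ⊑ D) ∣ P a satisfying probability distribution }
  ExtensionValue : KB → Axiom → ℝ → Set₁
  ExtensionValue K α x = Σ[ P ∈ Distribution ] (P Satisfies K × x ≈ᴿ prob P α)

-- Oracle procedures: while programs over natural-number registers, with
-- logarithmic costs, so that cost agrees up to a polynomial with running time
-- on an oracle Turing machine.  A program learns about the knowledge base only
-- through `query`, which asks whether adding P(C ⊑ D) ⋈ v keeps it satisfiable.

Register : Set
Register = ℕ

data Expr : Set where
  lit         : ℕ → Expr
  reg         : Register → Expr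
  _⊕_ _⊖_ _⊗_ : Expr → Expr → Expr

infixr 4 _⨟_
infix  5 _≔_

data Program : Set where
  skip            : Program
  _≔_             : Register → Expr → Program
  _⨟_             : Program → Program → Program
  if_<_then_else_ : Expr → Expr → Program → Program → Program
  while_<_loop_   : Expr → Expr → Program → Program
  query           : Register → Comparison → Expr → Expr → Program

Store : Set
Store = Register → ℕ

_[_↦_] : Store → Register → ℕ → Store
(s [ x ↦ n ]) y = if does (y ℕₚ.≟ x) then n else s y

eval : Store → Expr → ℕ
eval s (lit n) = n
eval s (reg x) = s x
eval s (e ⊕ f) = eval s e ℕ.+ eval s f
eval s (e ⊖ f) = eval s e ℕ.∸ eval s f
eval s (e ⊗ f) = eval s e ℕ.* eval s f

cost : Store → Expr → ℕ
cost s (lit n) = bits n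
cost s (reg x) = bits x ℕ.+ bits (s x)
cost s (e ⊕ f) = cost s e ℕ.+ cost s f ℕ.+ (bits (eval s e) ℕ.+ bits (eval s f))
cost s (e ⊖ f) = cost s e ℕ.+ cost s f ℕ.+ (bits (eval s e) ℕ.+ bits (eval s f))
cost s (e ⊗ f) = cost s e ℕ.+ cost s f ℕ.+ (bits (eval s e) ℕ.* bits (eval s f))

-- total, with n ÷ 0 = 0
_÷_ : ℕ → ℕ → ℚ
n ÷ zero  = 0ℚ
n ÷ suc d = + n ℚ./ suc d

module Execution (ask   : Comparison → ℚ → Bool)
                 (price : Comparison → ℚ → ℕ) where

  testCost : Store → Expr → Expr → ℕ
  testCost s e f = suc (cost s e ℕ.+ cost s f)

  -- Run p s t n w: from store s, program p halts in store t after n queries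
  -- and work w, excluding the oracle's own computation.
  data Run : Program → Store → Store → ℕ → ℕ → Set where
    run-skip : ∀ {s} → Run skip s s 0 1
    run-≔ : ∀ {s x e} →
      Run (x ≔ e) s (s [ x ↦ eval s e ]) 0 (suc (bits x ℕ.+ cost s e))
    run-⨟ : ∀ {s t u p q n n′ w w′} →
      Run p s t n w → Run q t u n′ w′ →
      Run (p ⨟ q) s u (n ℕ.+ n′) (w ℕ.+ w′)
    run-then : ∀ {s t e f p q n w} →
      eval s e ℕ.< eval s f → Run p s t n w →
      Run (if e < f then p else q) s t n (testCost s e f ℕ.+ w)
    run-else : ∀ {s t e f p q n w} →
      ¬ (eval s e ℕ.< eval s f) → Run q s t n w →
      Run (if e < f then p else q) s t n (testCost s e f ℕ.+ w)
    run-step : ∀ {s t u e f p n n′ w w′} →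
      eval s e ℕ.< eval s f → Run p s t n w →
      Run (while e < f loop p) t u n′ w′ →
      Run (while e < f loop p) s u (n ℕ.+ n′) (testCost s e f ℕ.+ w ℕ.+ w′)
    run-done : ∀ {s e f p} →
      ¬ (eval s e ℕ.< eval s f) →
      Run (while e < f loop p) s s 0 (testCost s e f)
    run-query : ∀ {s x ⋈ e f} →
      let v = eval s e ÷ eval s f in
      Run (query x ⋈ e f) s (s [ x ↦ (if ask ⋈ v then 1 else 0) ]) 1
          (suc (bits x ℕ.+ cost s e ℕ.+ cost s f ℕ.+ price ⋈ v))

-- ε enters as numerator and denominator in registers 0 and 1.
input : ℚ → Store
input ε 0 = ℤ.∣ ↥ ε ∣
input ε 1 = ↧ₙ ε
input ε _ = 0

-- The two results are left as fractions in registers 0, 1 and 2, 3.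
output-max output-min : Store → ℚ
output-max s = s 0 ÷ s 1
output-min s = s 2 ÷ s 3

module Procedure (S : Signature) (em : ExcludedMiddle 0ℓ) where
  open Syntax S
  open Semantics S em

  -- The work of a query is that of writing out the whole knowledge base asked about.
  module Calls (sat? : Decidable Satisfiable) (K : KB) (α : Axiom) = Execution
    (λ ⋈ v → does (sat? (addConstraint K (singleConstraint α ⋈ v))))
    (λ ⋈ v → sizeKB (addConstraint K (singleConstraint α ⋈ v)))

  open Calls public using (Run)

module Submission where

-- Bisection on [0, 1].  A query for P(C ⊑ D) ≥ v at the midpoint v of the current interval
-- tells which half contains the supremum: a positive answer exhibits an extension value
-- ≥ v, and a negative one makes v an upper bound of all of them.  Dually P(C ⊑ D) ≤ v
-- locates the infimum.  The two intervals are [2a/e, (2a+2)/e] and [2b/e, (2b+2)/e], where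
-- a, b and e are kept in registers 2, 3 and 4.  The loop stops at 1/e ≤ ε, when the
-- midpoints are within ε.  Since e starts at 2, no query is made for ε ≥ ½, as the bound
-- O(∣log ε∣) requires near ε = 1.

open import Defs
open import Axiom.ExcludedMiddle using (ExcludedMiddle)
open import Data.Bool.Base using (Bool; true; false; if_then_else_)
open import Data.Fin.Base using (Fin; zero; suc)
open import Data.Integer.Base as ℤ using (+_)
import Data.Integer.Properties as ℤₚ
import Data.Integer.Tactic.RingSolver as ℤ-Solver
open import Data.List.Base using ([]; map)
open import Data.List.NonEmpty.Base using (foldr₁) renaming (map to map⁺; _∷_ to _∷₁_)
open import Data.List.Relation.Unary.All as All using (_∷_)
open import Data.Nat.Base as ℕ
  using ( ℕ; zero; suc; _+_; _*_; _∸_; _^_; _⊔_; _≤_; s≤s; z≤n; ⌊_/2⌋; ⌈_/2⌉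
        ; NonZero; >-nonZero; >-nonZero⁻¹; ≢-nonZero)
open import Data.Nat.GCD using (gcd; gcd[m,n]≢0)
open import Data.Nat.ListAction using (sum)
open import Data.Nat.Logarithm
open import Data.Nat.Properties
open import Data.Nat.Tactic.RingSolver using (solve-∀)
open import Data.Product.Base using (_×_; _,_; proj₁; proj₂; ∃-syntax; Σ-syntax)
open import Data.Rational.Base as ℚ using (ℚ; 0ℚ; 1ℚ; ½; ↥_; ↧ₙ_; _<_)
import Data.Rational.Properties as ℚₚ
open import Data.Rational.Solver using (module +-*-Solver)
open import Data.Rational.Unnormalised.Base as ℚᵘ using (mkℚᵘ; *≡*; *≤*)
import Data.Rational.Unnormalised.Properties as ℚᵘₚ
open import Data.Sum.Base using (_⊎_; inj₁; inj₂)
open import Data.Unit.Base using (tt)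
open import Level using (0ℓ)
open import Relation.Binary.PropositionalEquality
open import Relation.Nullary using (¬_; Dec; yes; no; contradiction)
open import Relation.Nullary.Decidable.Core using (does)
open import Relation.Unary using (Decidable)

-- Bit lengths and costs

n<2^bits : ∀ n → n ℕ.< 2 ^ bits n
n<2^bits n = ≰⇒> λ 2^b≤n → 1+n≰n (begin
  bits n                ≡⟨ ⌊log₂[2^n]⌋≡n (bits n) ⟨
  ⌊log₂ (2 ^ bits n) ⌋  ≤⟨ ⌊log₂⌋-mono-≤ 2^b≤n ⟩
  ⌊log₂ n ⌋             ∎)
  where open ≤-Reasoning

⌊n/2⌋< : ∀ {n m} → n ℕ.< 2 * m → ⌊ n /2⌋ ℕ.< m
⌊n/2⌋< {n} {m} n<2m = ≰⇒> λ m≤n/2 → <⇒≱ n<2m (begin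
  2 * m                  ≡⟨ cong (λ k → m + k) (+-identityʳ m) ⟩
  m + m                  ≤⟨ +-mono-≤ m≤n/2 (≤-trans m≤n/2 (⌊n/2⌋≤⌈n/2⌉ n)) ⟩
  ⌊ n /2⌋ + ⌈ n /2⌉      ≡⟨ ⌊n/2⌋+⌈n/2⌉≡n n ⟩
  n                      ∎)
  where open ≤-Reasoning

-- By induction on `b`, halving `n`: this lowers both the exponent and `⌊log₂ n ⌋` by one. The
-- exponent is a successor because `bits` is at least 1, even at 0.
<2^⇒bits≤ : ∀ {n} b → n ℕ.< 2 ^ suc b → bits n ≤ suc b
<2^⇒bits≤ {zero}        zero    _ = ≤-refl
<2^⇒bits≤ {suc zero}    zero    _ = ≤-refl
<2^⇒bits≤ {suc (suc n)} zero    (s≤s (s≤s ()))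
<2^⇒bits≤ {n}           (suc b) n<2^ = s≤s (begin
  ⌊log₂ n ⌋              ≤⟨ m≤n+m∸n ⌊log₂ n ⌋ 1 ⟩
  suc (⌊log₂ n ⌋ ∸ 1)    ≡⟨ cong suc (⌊log₂⌊n/2⌋⌋≡⌊log₂n⌋∸1 n) ⟨
  bits ⌊ n /2⌋           ≤⟨ <2^⇒bits≤ b (⌊n/2⌋< n<2^) ⟩
  suc b                  ∎)
  where open ≤-Reasoning

bits-mono : ∀ {m n} → m ≤ n → bits m ≤ bits n
bits-mono m≤n = s≤s (⌊log₂⌋-mono-≤ m≤n)

bits-* : ∀ m n → bits (m * n) ≤ bits m + bits n
bits-* m n = <2^⇒bits≤ _ (begin-strict
  m * n                     <⟨ *-mono-< (n<2^bits m) (n<2^bits n) ⟩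
  2 ^ bits m * 2 ^ bits n   ≡⟨ ^-distribˡ-+-* 2 (bits m) (bits n) ⟨
  2 ^ (bits m + bits n)     ∎)
  where open ≤-Reasoning

m+n≤2*m*n : ∀ m n .{{_ : NonZero m}} .{{_ : NonZero n}} → m + n ≤ 2 * (m * n)
m+n≤2*m*n m n = begin
  m + n             ≤⟨ +-mono-≤ (m≤m*n m n) (m≤n*m n m) ⟩
  m * n + m * n     ≡⟨ cong (λ k → m * n + k) (+-identityʳ (m * n)) ⟨
  2 * (m * n)       ∎
  where open ≤-Reasoning

-- Cruder than the usual bound with one carry bit, but of the same form as `bits-*`, so that sums
-- and products can be treated alike. It comes from `x + y ≤ 2xy` for the positive powers of two `x`
-- and `y`.
bits-+ : ∀ m n → bits (m + n) ≤ bits m + bits n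
bits-+ m n = <2^⇒bits≤ _ (begin-strict
  m + n                               <⟨ +-mono-< (n<2^bits m) (n<2^bits n) ⟩
  2 * x + 2 * y                       ≡⟨ *-distribˡ-+ 2 x y ⟨
  2 * (x + y)                         ≤⟨ *-monoʳ-≤ 2 (m+n≤2*m*n x y) ⟩
  2 * (2 * (x * y))                   ≡⟨ lemma x y ⟩
  (2 * x) * (2 * y)                   ≡⟨ ^-distribˡ-+-* 2 (bits m) (bits n) ⟨
  2 ^ (bits m + bits n)               ∎)
  where
  open ≤-Reasoning
  x = 2 ^ ⌊log₂ m ⌋
  y = 2 ^ ⌊log₂ n ⌋
  instance
    x≢0 : NonZero x
    x≢0 = m^n≢0 2 ⌊log₂ m ⌋
    y≢0 : NonZero y
    y≢0 = m^n≢0 2 ⌊log₂ n ⌋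
  lemma : ∀ x y → 2 * (2 * (x * y)) ≡ (2 * x) * (2 * y)
  lemma = solve-∀

-- A factor independent of the store: with registers of at most `B` bits, the value of `e` has at
-- most `size e * B` bits, and evaluation costs at most the square of that. A register counts its
-- index as well, since `cost` charges for it.
size : Expr → ℕ
size (lit n) = bits n
size (reg x) = suc (bits x)
size (e ⊕ f) = size e + size f
size (e ⊖ f) = size e + size f
size (e ⊗ f) = size e + size f

size≢0 : ∀ e → NonZero (size e)
size≢0 (lit n) = _
size≢0 (reg x) = _
size≢0 (e ⊕ f) = >-nonZero (≤-trans (>-nonZero⁻¹ _ {{size≢0 e}}) (m≤m+n _ _))
size≢0 (e ⊖ f) = >-nonZero (≤-trans (>-nonZero⁻¹ _ {{size≢0 e}}) (m≤m+n _ _))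
size≢0 (e ⊗ f) = >-nonZero (≤-trans (>-nonZero⁻¹ _ {{size≢0 e}}) (m≤m+n _ _))

record Small (B : ℕ) (s : Store) : Set where
  constructor small
  field bits≤ : ∀ x → bits (s x) ≤ B

open Small public

module _ {B} .{{_ : NonZero B}} {s} (sm : Small B s) where

  bits-eval : ∀ e → bits (eval s e) ≤ size e * B
  private
    bits-eval₂ : ∀ e f → bits (eval s e) + bits (eval s f) ≤ (size e + size f) * B
  bits-eval (lit n) = m≤m*n (bits n) B
  bits-eval (reg x) = ≤-trans (bits≤ sm x) (m≤n*m B (suc (bits x)))
  bits-eval (e ⊕ f) = ≤-trans (bits-+ (eval s e) (eval s f)) (bits-eval₂ e f)
  bits-eval (e ⊖ f) =
    ≤-trans (bits-mono (m∸n≤m (eval s e) (eval s f)))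
      (≤-trans (bits-eval e) (*-monoˡ-≤ B (m≤m+n (size e) (size f))))
  bits-eval (e ⊗ f) = ≤-trans (bits-* (eval s e) (eval s f)) (bits-eval₂ e f)
  bits-eval₂ e f = ≤-trans (+-mono-≤ (bits-eval e) (bits-eval f))
    (≤-reflexive (sym (*-distribʳ-+ B (size e) (size f))))

  private
    square≥ : ∀ {m n} → m ≤ n → m ≤ n * n
    square≥ {n = zero}  m≤n = m≤n
    square≥ {n = suc n} m≤n = ≤-trans m≤n (m≤m*n (suc n) (suc n))

  -- Squares absorb the cost of one operation: x² + y² + 2xy = (x + y)².
  cost≤ : ∀ e → cost s e ≤ (size e * B) * (size e * B)
  private
    cost₂ : ∀ e f {c} → c ≤ 2 * ((size e * B) * (size f * B)) →
            cost s e + cost s f + c ≤ ((size e + size f) * B) * ((size e + size f) * B)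
    sum≤ : ∀ e f → bits (eval s e) + bits (eval s f) ≤ 2 * ((size e * B) * (size f * B))
  cost≤ (lit n) = square≥ (m≤m*n (bits n) B)
  cost≤ (reg x) = square≥ (≤-trans (≤-reflexive (+-comm (bits x) _))
    (+-mono-≤ (bits≤ sm x) (m≤m*n (bits x) B)))
  cost≤ (e ⊕ f) = cost₂ e f (sum≤ e f)
  cost≤ (e ⊖ f) = cost₂ e f (sum≤ e f)
  cost≤ (e ⊗ f) = cost₂ e f
    (≤-trans (*-mono-≤ (bits-eval e) (bits-eval f)) (m≤m+n _ _))
  cost₂ e f {c} c≤ = begin
    cost s e + cost s f + c              ≤⟨ +-mono-≤ (+-mono-≤ (cost≤ e) (cost≤ f)) c≤ ⟩
    (size e * B) * (size e * B) + (size f * B) * (size f * B) + 2 * ((size e * B) * (size f * B))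
                                         ≡⟨ lemma (size e) (size f) B ⟩
    ((size e + size f) * B) * ((size e + size f) * B) ∎
    where
    open ≤-Reasoning
    lemma : ∀ x y b → (x * b) * (x * b) + (y * b) * (y * b) + 2 * ((x * b) * (y * b))
                      ≡ ((x + y) * b) * ((x + y) * b)
    lemma = solve-∀
  sum≤ e f = ≤-trans (+-mono-≤ (bits-eval e) (bits-eval f))
    (m+n≤2*m*n (size e * B) (size f * B)
      {{m*n≢0 (size e) B {{size≢0 e}}}} {{m*n≢0 (size f) B {{size≢0 f}}}})

-- Real numbers

halve : ∀ {ε} → 0ℚ ℚ.< ε → 0ℚ ℚ.< ½ ℚ.* ε
halve {ε} 0<ε = ℚₚ.positive⁻¹ (½ ℚ.* ε) {{ℚₚ.pos*pos⇒pos ½ ε {{ℚ.positive 0<ε}}}}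

module _ where
  open +-*-Solver

  +½+½ : ∀ p ε → p ℚ.+ ½ ℚ.* ε ℚ.+ ½ ℚ.* ε ≡ p ℚ.+ ε
  +½+½ = solve 2 (λ p e → p :+ con ½ :* e :+ con ½ :* e := p :+ e) refl

  p-q+q≡p : ∀ p q → p ℚ.- q ℚ.+ q ≡ p
  p-q+q≡p = solve 2 (λ p q → p :- q :+ q := p) refl

  ℚ-interchange : ∀ a b c d → (a ℚ.+ b) ℚ.+ (c ℚ.+ d) ≡ (a ℚ.+ c) ℚ.+ (b ℚ.+ d)
  ℚ-interchange = solve 4 (λ a b c d → (a :+ b) :+ (c :+ d) := (a :+ c) :+ (b :+ d)) refl

p≤∣p∣ : ∀ p → p ℚ.≤ ℚ.∣ p ∣
p≤∣p∣ p with ℚₚ.≤-total 0ℚ p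
... | inj₁ 0≤p = ℚₚ.≤-reflexive (sym (ℚₚ.0≤p⇒∣p∣≡p 0≤p))
... | inj₂ p≤0 = ℚₚ.≤-trans p≤0 (ℚₚ.0≤∣p∣ p)

p+r≤q+r⇒p≤q : ∀ {p q r} → p ℚ.+ r ℚ.≤ q ℚ.+ r → p ℚ.≤ q
p+r≤q+r⇒p≤q {r = r} h = ℚₚ.≮⇒≥ λ q<p → ℚₚ.<-irrefl refl (ℚₚ.<-≤-trans (ℚₚ.+-monoˡ-< r q<p) h)

p≤p+ε : ∀ {p ε} → 0ℚ ℚ.< ε → p ℚ.≤ p ℚ.+ ε
p≤p+ε {p} {ε} 0<ε = subst (ℚ._≤ p ℚ.+ ε) (ℚₚ.+-identityʳ p) (ℚₚ.+-monoʳ-≤ p (ℚₚ.<⇒≤ 0<ε))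

≤ᴿ-pointwise : ∀ {x y} → (∀ n → seq x n ℚ.≤ seq y n) → x ≤ᴿ y
≤ᴿ-pointwise x≤y ε 0<ε = 0 , λ n _ → ℚₚ.≤-trans (x≤y n) (p≤p+ε 0<ε)

≤ᴿ-refl : ∀ {x} → x ≤ᴿ x
≤ᴿ-refl {x} = ≤ᴿ-pointwise {x} {x} λ _ → ℚₚ.≤-refl

-- An inequality between reals mentions only their sequences, from which the Cauchy proofs cannot be
-- recovered; hence the reals are given explicitly at each use.
≤ᴿ-trans : ∀ {x y z} → x ≤ᴿ y → y ≤ᴿ z → x ≤ᴿ z
≤ᴿ-trans {x} {y} {z} x≤y y≤z ε 0<ε with x≤y _ (halve 0<ε) | y≤z _ (halve 0<ε)
... | M , p | N , q = M ⊔ N , λ n n≥ → begin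
  seq x n                              ≤⟨ p n (m⊔n≤o⇒m≤o M N n≥) ⟩
  seq y n ℚ.+ ½ ℚ.* ε                  ≤⟨ ℚₚ.+-monoˡ-≤ _ (q n (m⊔n≤o⇒n≤o M N n≥)) ⟩
  seq z n ℚ.+ ½ ℚ.* ε ℚ.+ ½ ℚ.* ε      ≡⟨ +½+½ (seq z n) ε ⟩
  seq z n ℚ.+ ε                        ∎
  where open ℚₚ.≤-Reasoning

∣p-q∣≤δ⇒p≤q+δ : ∀ {p q δ} → ℚ.∣ p ℚ.- q ∣ ℚ.≤ δ → p ℚ.≤ q ℚ.+ δ
∣p-q∣≤δ⇒p≤q+δ {p} {q} {δ} h = begin
  p                   ≡⟨ p-q+q≡p p q ⟨
  p ℚ.- q ℚ.+ q       ≤⟨ ℚₚ.+-monoˡ-≤ q (ℚₚ.≤-trans (p≤∣p∣ (p ℚ.- q)) h) ⟩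
  δ ℚ.+ q             ≡⟨ ℚₚ.+-comm δ q ⟩
  q ℚ.+ δ             ∎
  where open ℚₚ.≤-Reasoning

-- Comparing x and y at one index, up to ½ε, decides between y ≤ x + ε and x ≤ y on a tail.
≰ᴿ⇒≥ᴿ : ∀ {x y} → ¬ x ≤ᴿ y → y ≤ᴿ x
≰ᴿ⇒≥ᴿ {x} {y} x≰y ε 0<ε = N , bound
  where
  open ℚₚ.≤-Reasoning
  -- A quarter of `ε`: two Cauchy errors `δ` exhaust a gap of `½ ε` at index `N`, and together with
  -- such a gap they add up to `ε`.
  δ = ½ ℚ.* (½ ℚ.* ε)
  0<δ = halve (halve 0<ε)
  M₁ = proj₁ (cauchy x δ 0<δ)
  M₂ = proj₁ (cauchy y δ 0<δ)
  N = M₁ ⊔ M₂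
  closeˣ : ∀ m n → N ≤ m → N ≤ n → seq x m ℚ.≤ seq x n ℚ.+ δ
  closeˣ m n m≥ n≥ = ∣p-q∣≤δ⇒p≤q+δ
    (proj₂ (cauchy x δ 0<δ) m n (m⊔n≤o⇒m≤o M₁ M₂ m≥) (m⊔n≤o⇒m≤o M₁ M₂ n≥))
  closeʸ : ∀ m n → N ≤ m → N ≤ n → seq y m ℚ.≤ seq y n ℚ.+ δ
  closeʸ m n m≥ n≥ = ∣p-q∣≤δ⇒p≤q+δ
    (proj₂ (cauchy y δ 0<δ) m n (m⊔n≤o⇒n≤o M₁ M₂ m≥) (m⊔n≤o⇒n≤o M₁ M₂ n≥))
  close-N : seq y N ℚ.≤ seq x N ℚ.+ ½ ℚ.* ε
  close-N = ℚₚ.≮⇒≥ λ x+½ε<y → x≰y λ η 0<η → N , λ n n≥ → begin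
    seq x n                      ≤⟨ closeˣ n N n≥ ≤-refl ⟩
    seq x N ℚ.+ δ                ≤⟨ p+r≤q+r⇒p≤q (begin
      seq x N ℚ.+ δ ℚ.+ δ          ≡⟨ +½+½ (seq x N) (½ ℚ.* ε) ⟩
      seq x N ℚ.+ ½ ℚ.* ε          ≤⟨ ℚₚ.<⇒≤ x+½ε<y ⟩
      seq y N                      ≤⟨ closeʸ N n ≤-refl n≥ ⟩
      seq y n ℚ.+ δ                ∎) ⟩
    seq y n                      ≤⟨ p≤p+ε 0<η ⟩
    seq y n ℚ.+ η                ∎
  bound : ∀ n → N ≤ n → seq y n ℚ.≤ seq x n ℚ.+ ε
  bound n n≥ = begin
    seq y n                             ≤⟨ closeʸ n N n≥ ≤-refl ⟩
    seq y N ℚ.+ δ                       ≤⟨ ℚₚ.+-monoˡ-≤ δ close-N ⟩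
    seq x N ℚ.+ ½ ℚ.* ε ℚ.+ δ           ≤⟨ ℚₚ.+-monoˡ-≤ δ (ℚₚ.+-monoˡ-≤ _ (closeˣ N n ≤-refl n≥)) ⟩
    seq x n ℚ.+ δ ℚ.+ ½ ℚ.* ε ℚ.+ δ     ≡⟨ rearrange (seq x n) ε ⟩
    seq x n ℚ.+ ε                       ∎
    where
    rearrange : ∀ p ε → p ℚ.+ ½ ℚ.* (½ ℚ.* ε) ℚ.+ ½ ℚ.* ε ℚ.+ ½ ℚ.* (½ ℚ.* ε) ≡ p ℚ.+ ε
    rearrange = solve 2 (λ p e →
      p :+ con ½ :* (con ½ :* e) :+ con ½ :* e :+ con ½ :* (con ½ :* e) := p :+ e) refl
      where open +-*-Solver

+ᴿ-mono : ∀ {x y u v} → x ≤ᴿ y → u ≤ᴿ v → x +ᴿ u ≤ᴿ y +ᴿ v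
+ᴿ-mono {x} {y} {u} {v} x≤y u≤v ε 0<ε with x≤y _ (halve 0<ε) | u≤v _ (halve 0<ε)
... | M , p | N , q = M ⊔ N , λ n n≥ → begin
  seq x n ℚ.+ seq u n
    ≤⟨ ℚₚ.+-mono-≤ (p n (m⊔n≤o⇒m≤o M N n≥)) (q n (m⊔n≤o⇒n≤o M N n≥)) ⟩
  (seq y n ℚ.+ ½ ℚ.* ε) ℚ.+ (seq v n ℚ.+ ½ ℚ.* ε)
    ≡⟨ ℚ-interchange (seq y n) (½ ℚ.* ε) (seq v n) (½ ℚ.* ε) ⟩
  (seq y n ℚ.+ seq v n) ℚ.+ (½ ℚ.* ε ℚ.+ ½ ℚ.* ε)
    ≡⟨ ℚₚ.+-assoc (seq y n ℚ.+ seq v n) _ _ ⟨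
  (seq y n ℚ.+ seq v n) ℚ.+ ½ ℚ.* ε ℚ.+ ½ ℚ.* ε
    ≡⟨ +½+½ (seq y n ℚ.+ seq v n) ε ⟩
  (seq y n ℚ.+ seq v n) ℚ.+ ε ∎
  where open ℚₚ.≤-Reasoning

∑ᴿ-mono : ∀ {m} {f g : Fin m → ℝ} → (∀ i → f i ≤ᴿ g i) → ∑ᴿ f ≤ᴿ ∑ᴿ g
∑ᴿ-mono {zero}          f≤g = ≤ᴿ-refl {0ᴿ}
∑ᴿ-mono {suc m} {f} {g} f≤g =
  +ᴿ-mono {f zero} {g zero} {∑ᴿ (λ i → f (suc i))} {∑ᴿ (λ i → g (suc i))}
    (f≤g zero) (∑ᴿ-mono (λ i → f≤g (suc i)))

∑ᴿ-nonneg : ∀ {m} {f : Fin m → ℝ} → (∀ i → 0ᴿ ≤ᴿ f i) → 0ᴿ ≤ᴿ ∑ᴿ f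
∑ᴿ-nonneg {zero}      0≤f = ≤ᴿ-refl {0ᴿ}
∑ᴿ-nonneg {suc m} {f} 0≤f =
  +ᴿ-mono {0ᴿ} {f zero} {0ᴿ} {∑ᴿ (λ i → f (suc i))} (0≤f zero) (∑ᴿ-nonneg (λ i → 0≤f (suc i)))

fromℚ-mono : ∀ {p q} → p ℚ.≤ q → fromℚ p ≤ᴿ fromℚ q
fromℚ-mono {p} {q} p≤q = ≤ᴿ-pointwise {fromℚ p} {fromℚ q} λ _ → p≤q

-- Fractions and bisection intervals

÷-+ : ∀ m n e → (m + n) ÷ e ≡ m ÷ e ℚ.+ n ÷ e
÷-+ m n zero    = refl
-- Since `÷` reduces to lowest terms, the identity is checked on unnormalised fractions, by
-- cross-multiplication.
÷-+ m n (suc d) = ℚₚ.toℚᵘ-injective (begin-equality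
  ℚ.toℚᵘ ((m + n) ÷ suc d)                         ≃⟨ ℚₚ.toℚᵘ-fromℚᵘ (mkℚᵘ (+ (m + n)) d) ⟩
  mkℚᵘ (+ (m + n)) d                               ≃⟨ *≡* (lemma (+ m) (+ n) (+ suc d)) ⟩
  mkℚᵘ (+ m) d ℚᵘ.+ mkℚᵘ (+ n) d                   ≃⟨ ℚᵘₚ.+-cong
    (ℚₚ.toℚᵘ-fromℚᵘ (mkℚᵘ (+ m) d)) (ℚₚ.toℚᵘ-fromℚᵘ (mkℚᵘ (+ n) d)) ⟨
  ℚ.toℚᵘ (m ÷ suc d) ℚᵘ.+ ℚ.toℚᵘ (n ÷ suc d)       ≃⟨ ℚₚ.toℚᵘ-homo-+ (m ÷ suc d) (n ÷ suc d) ⟨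
  ℚ.toℚᵘ (m ÷ suc d ℚ.+ n ÷ suc d)                 ∎)
  where
  open ℚᵘₚ.≤-Reasoning
  lemma : ∀ m n e → (m ℤ.+ n) ℤ.* (e ℤ.* e) ≡ (m ℤ.* e ℤ.+ n ℤ.* e) ℤ.* e
  lemma = ℤ-Solver.solve-∀

÷-cancelˡ : ∀ k n e .{{_ : NonZero k}} → (k * n) ÷ (k * e) ≡ n ÷ e
÷-cancelˡ k n zero rewrite *-zeroʳ k = refl
÷-cancelˡ k@(suc _) n e@(suc d) = ℚₚ.fromℚᵘ-cong {mkℚᵘ (+ (k * n)) _} {mkℚᵘ (+ n) d} (*≡* (begin
  + (k * n) ℤ.* + e          ≡⟨ ℤₚ.pos-* (k * n) e ⟨
  + (k * n * e)              ≡⟨ cong +_ (trans (cong (_* e) (*-comm k n)) (*-assoc n k e)) ⟩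
  + (n * (k * e))            ≡⟨ ℤₚ.pos-* n (k * e) ⟩
  + n ℤ.* + (k * e)          ∎))
  where open ≡-Reasoning

÷-≤ : ∀ {m e q} .{{_ : NonZero e}} → + m ℤ.* ℚ.↧ q ℤ.≤ ℚ.↥ q ℤ.* + e → m ÷ e ℚ.≤ q
÷-≤ {m} {suc d} {q@record{}} h = ℚₚ.toℚᵘ-cancel-≤
  (ℚᵘₚ.≤-respˡ-≃ (ℚᵘₚ.≃-sym (ℚₚ.toℚᵘ-fromℚᵘ (mkℚᵘ (+ m) d))) (*≤* h))

-- Reduction divides numerator and denominator by their gcd, so neither grows. This bounds the price
-- of writing out a queried value.
sizeℚ-÷ : ∀ n e → sizeℚ (n ÷ e) ≤ bits n + bits e
sizeℚ-÷ n zero    = +-monoˡ-≤ 1 (s≤s z≤n)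
sizeℚ-÷ n (suc d) = +-mono-≤ (bits-mono num≤) (bits-mono den≤)
  where
  q = n ÷ suc d
  g = gcd n (suc d)
  instance
    g≢0 : NonZero g
    g≢0 = ≢-nonZero (gcd[m,n]≢0 n (suc d) (inj₂ λ ()))
  num≤ : ℤ.∣ ↥ q ∣ ≤ n
  num≤ = subst (ℤ.∣ ↥ q ∣ ≤_)
    (trans (sym (ℤₚ.abs-* (↥ q) (+ g))) (cong ℤ.∣_∣ (ℚₚ.↥-normalize n (suc d))))
    (m≤m*n ℤ.∣ ↥ q ∣ g)
  den≤ : ↧ₙ q ≤ suc d
  den≤ = subst (↧ₙ q ≤_)
    (trans (sym (ℤₚ.abs-* (ℚ.↧ q) (+ g))) (cong ℤ.∣_∣ (ℚₚ.↧-normalize n (suc d))))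
    (m≤m*n (↧ₙ q) g)

-- Ties the exit test of the loop to the precision: the second hypothesis is `1/e ≤ ε` cleared of
-- denominators. For `e = 0` the quotient is 0 by convention.
1÷e≤ : ∀ {e ε} → 0ℚ ℚ.< ε → ↧ₙ ε ≤ e * ℤ.∣ ↥ ε ∣ → 1 ÷ e ℚ.≤ ε
1÷e≤ {zero}                  0<ε _    = ℚₚ.<⇒≤ 0<ε
1÷e≤ {e@(suc _)} {ε@record{}} 0<ε den≤ = ÷-≤ {1} {e} (begin
  + 1 ℤ.* ℚ.↧ ε              ≡⟨ ℤₚ.*-identityˡ (ℚ.↧ ε) ⟩
  + ↧ₙ ε                     ≤⟨ ℤ.+≤+ den≤ ⟩
  + (e * ℤ.∣ ↥ ε ∣)          ≡⟨ ℤₚ.pos-* e ℤ.∣ ↥ ε ∣ ⟩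
  + e ℤ.* + ℤ.∣ ↥ ε ∣        ≡⟨ ℤₚ.*-comm (+ e) (+ ℤ.∣ ↥ ε ∣) ⟩
  + ℤ.∣ ↥ ε ∣ ℤ.* + e        ≡⟨ cong (ℤ._* + e) (cong ↥_ (ℚₚ.0≤p⇒∣p∣≡p (ℚₚ.<⇒≤ 0<ε))) ⟩
  ↥ ε ℤ.* + e                ∎)
  where open ℤₚ.≤-Reasoning

-- Even numerators at both ends make the midpoint `(2 * a + 1) ÷ e` a fraction over the same `e`.
-- The initial interval [0, 1] is `a = 0`, `e = 2`.
Bracket : ℕ → ℕ → ℝ → Set
Bracket a e x = fromℚ ((2 * a) ÷ e) ≤ᴿ x × x ≤ᴿ fromℚ ((2 * a + 2) ÷ e)

module _ (a e : ℕ) (x : ℝ) where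
  private
    -- The ends of a half are an end and the midpoint of the old interval, with numerator and
    -- denominator doubled.
    double : ∀ {m n} → m ≡ 2 * n → m ÷ (2 * e) ≡ n ÷ e
    double {n = n} refl = ÷-cancelˡ 2 n e

  upper-half : Bracket a e x → fromℚ ((2 * a + 1) ÷ e) ≤ᴿ x →
               Bracket (2 * a + 1) (2 * e) x
  upper-half (_ , x≤) mid≤ =
      subst (λ q → fromℚ q ≤ᴿ x) (sym (double {n = 2 * a + 1} refl)) mid≤
    , subst (λ q → x ≤ᴿ fromℚ q) (sym (double {n = 2 * a + 2} (lemma (2 * a)))) x≤
    where
    lemma : ∀ m → 2 * (m + 1) + 2 ≡ 2 * (m + 2)
    lemma m = sym (trans (cong (2 *_) (sym (+-assoc m 1 1))) (*-distribˡ-+ 2 (m + 1) 1))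

  lower-half : Bracket a e x → x ≤ᴿ fromℚ ((2 * a + 1) ÷ e) →
               Bracket (2 * a) (2 * e) x
  lower-half (≤x , _) ≤mid =
      subst (λ q → fromℚ q ≤ᴿ x) (sym (double {n = 2 * a} refl)) ≤x
    , subst (λ q → x ≤ᴿ fromℚ q)
        (sym (double {n = 2 * a + 1} (sym (*-distribˡ-+ 2 (2 * a) 1)))) ≤mid

  -- The interval has half-length `1 ÷ e`.
  midpoint-within : ∀ {ε} → 1 ÷ e ℚ.≤ ε → Bracket a e x → Within ε ((2 * a + 1) ÷ e) x
  midpoint-within {ε} 1/e≤ε (≤x , x≤) =
      ≤ᴿ-trans {fromℚ (mid ℚ.- ε)} {fromℚ ((2 * a) ÷ e)} {x} (fromℚ-mono (begin
        mid ℚ.- ε                          ≡⟨ cong (ℚ._- ε) (÷-+ (2 * a) 1 e) ⟩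
        (2 * a) ÷ e ℚ.+ 1 ÷ e ℚ.- ε        ≤⟨ ℚₚ.+-monoˡ-≤ (ℚ.- ε) (ℚₚ.+-monoʳ-≤ ((2 * a) ÷ e) 1/e≤ε) ⟩
        (2 * a) ÷ e ℚ.+ ε ℚ.- ε            ≡⟨ p+q-q≡p ((2 * a) ÷ e) ε ⟩
        (2 * a) ÷ e                        ∎)) ≤x
    , ≤ᴿ-trans {x} {fromℚ ((2 * a + 2) ÷ e)} {fromℚ (mid ℚ.+ ε)} x≤ (fromℚ-mono (begin
        (2 * a + 2) ÷ e        ≡⟨ cong (_÷ e) (+-assoc (2 * a) 1 1) ⟨
        (2 * a + 1 + 1) ÷ e    ≡⟨ ÷-+ (2 * a + 1) 1 e ⟩
        mid ℚ.+ 1 ÷ e          ≤⟨ ℚₚ.+-monoʳ-≤ mid 1/e≤ε ⟩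
        mid ℚ.+ ε              ∎))
    where
    open ℚₚ.≤-Reasoning
    mid = (2 * a + 1) ÷ e
    p+q-q≡p : ∀ p q → p ℚ.+ q ℚ.- q ≡ p
    p+q-q≡p p q = trans (ℚₚ.+-assoc p q (ℚ.- q))
      (trans (cong (p ℚ.+_) (ℚₚ.+-inverseʳ q)) (ℚₚ.+-identityʳ p))

-- The bisection program

Small-update : ∀ {B s n} x → bits n ≤ B → Small B s → Small B (s [ x ↦ n ])
Small-update {B} {s} {n} x n≤ sm = small bound
  where
  bound : ∀ y → bits ((s [ x ↦ n ]) y) ≤ B
  bound y with does (y ≟ x)
  ... | true  = n≤
  ... | false = bits≤ sm y

midpoint : Register → Expr
midpoint x = (lit 2 ⊗ reg x) ⊕ lit 1

-- Registers 5 and 6 receive the answers. A positive answer moves `a` to the upper half, so it is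
-- added; it moves `b` to the lower half, so it is subtracted. The loop test is `1/e > ε` cleared of
-- denominators.
body loop finish procedure : Program
body =
  query 5 ge (midpoint 2) (reg 4) ⨟
  query 6 le (midpoint 3) (reg 4) ⨟
  2 ≔ (lit 2 ⊗ reg 2) ⊕ reg 5 ⨟
  3 ≔ midpoint 3 ⊖ reg 6 ⨟
  4 ≔ lit 2 ⊗ reg 4
loop = while reg 4 ⊗ reg 0 < reg 1 loop body
-- The order matters: registers 2 and 3 still hold `a` and `b` when their midpoints are computed.
finish = 0 ≔ midpoint 2 ⨟ 1 ≔ reg 4 ⨟ 2 ≔ midpoint 3 ⨟ 3 ≔ reg 4
procedure = 4 ≔ lit 2 ⨟ loop ⨟ finish

indicator : Bool → ℕ
indicator b = if b then 1 else 0

indicator≤1 : ∀ b → indicator b ≤ 1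
indicator≤1 true  = ≤-refl
indicator≤1 false = z≤n

-- The run is analysed for an arbitrary oracle. Its answers only have to preserve `U` and `V`, which
-- are later instantiated by the brackets around the supremum and the infimum.
module Bisection
  (ask   : Comparison → ℚ → Bool)
  (price : Comparison → ℚ → ℕ)
  (B : ℕ) (price≤ : ∀ ⋈ v → price ⋈ v ≤ 4 * B + sizeℚ v)
  {ℓ} (U V : ℕ → ℕ → Set ℓ)
  (U-halve : ∀ a e → U a e → U (2 * a + indicator (ask ge ((2 * a + 1) ÷ e))) (2 * e))
  (V-halve : ∀ b e → V b e → V (2 * b + 1 ∸ indicator (ask le ((2 * b + 1) ÷ e))) (2 * e))
  where
  open Execution ask price

  Q = B * B

  record Invariant (j : ℕ) (s : Store) : Set ℓ where
    field
      scale : s 4 ≡ 2 ^ suc j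
      -- The right ends of both intervals stay at most 1, so numerators of midpoints are no longer
      -- than `e`.
      left  : 2 * suc (s 2) ≤ s 4
      right : 2 * suc (s 3) ≤ s 4
      -- 2ʲ ≤ 1/ε unless no iteration has been made: this bounds the number of queries.
      guard : j ≡ 0 ⊎ 2 ^ j * s 0 ≤ s 1
      sm    : Small B s
      -- e may reach 2 · den(ε), one bit more than den(ε).
      room  : suc (bits (s 1)) ≤ B
      upper : U (s 2) (s 4)
      lower : V (s 3) (s 4)

  -- c stays a variable: conversion checking would unfold 1100 * Q into 1100 summands.
  module _ (0<B : 0 ℕ.< B) (c : ℕ) (1100≤c : 1100 ≤ c) where
    private instance
      B≢0 : NonZero B
      B≢0 = >-nonZero 0<B
      Q≢0 : NonZero Q
      Q≢0 = m*n≢0 B B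

    -- A record, because c cannot be inferred from w ≤ c * Q by unification.
    infix 4 _≲_
    record _≲_ (w c : ℕ) : Set where
      constructor ⌞_⌟
      field bound : w ≤ c * Q
    open _≲_

    infixr 6 _⊹_
    _⊹_ : ∀ {v w c d} → v ≲ c → w ≲ d → v + w ≲ c + d
    _⊹_ {c = c} {d} ⌞ v≤ ⌟ ⌞ w≤ ⌟ =
      ⌞ ≤-trans (+-mono-≤ v≤ w≤) (≤-reflexive (sym (*-distribʳ-+ Q c d))) ⌟

    raise : ∀ {w c d} → c ≤ d → w ≲ c → w ≲ d
    raise c≤d ⌞ w≤ ⌟ = ⌞ ≤-trans w≤ (*-monoˡ-≤ Q c≤d) ⌟

    const≲ : ∀ c → c ≲ c
    const≲ c = ⌞ m≤m*n c Q ⌟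

    weight : Expr → ℕ
    weight e = size e * size e

    cost≲ : ∀ {s} → Small B s → ∀ e → cost s e ≲ weight e
    cost≲ sm e = ⌞ ≤-trans (cost≤ sm e) (≤-reflexive (lemma (size e) B)) ⌟
      where
      lemma : ∀ x b → (x * b) * (x * b) ≡ (x * x) * (b * b)
      lemma = solve-∀

    assign≲ : ∀ {s} x e → Small B s → suc (bits x + cost s e) ≲ suc (bits x) + weight e
    assign≲ x e sm = const≲ (suc (bits x)) ⊹ cost≲ sm e

    test≲ : ∀ {s} e f → Small B s → testCost s e f ≲ 1 + weight e + weight f
    test≲ e f sm = (const≲ 1 ⊹ cost≲ sm e) ⊹ cost≲ sm f

    -- The 6 covers the price: `4 * B` for the knowledge base with the axiom, and `B` each for the
    -- numerator and denominator of the queried value.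
    query≲ : ∀ {s} x ⋈ e f → Small B s → bits (eval s e) ≤ B → bits (eval s f) ≤ B →
             suc (bits x + cost s e + cost s f + price ⋈ (eval s e ÷ eval s f))
             ≲ suc (bits x) + weight e + weight f + 6
    query≲ {s} x ⋈ e f sm e≤B f≤B =
      (assign≲ x e sm ⊹ cost≲ sm f) ⊹
        ⌞ (begin
          price ⋈ (eval s e ÷ eval s f)               ≤⟨ price≤ ⋈ _ ⟩
          4 * B + sizeℚ (eval s e ÷ eval s f)         ≤⟨ +-monoʳ-≤ (4 * B) (sizeℚ-÷ (eval s e) (eval s f)) ⟩
          4 * B + (bits (eval s e) + bits (eval s f)) ≤⟨ +-monoʳ-≤ (4 * B) (+-mono-≤ e≤B f≤B) ⟩
          4 * B + (B + B)                             ≡⟨ lemma B ⟩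
          6 * B                                       ≤⟨ *-monoʳ-≤ 6 (m≤m*n B B) ⟩
          6 * Q                                       ∎) ⌟
      where
      open ≤-Reasoning
      lemma : ∀ b → 4 * b + (b + b) ≡ 6 * b
      lemma = solve-∀

    1+[2m+1]≡ : ∀ m → suc (2 * m + 1) ≡ 2 * suc m
    1+[2m+1]≡ = solve-∀

    midpoint≤ : ∀ {m e} → 2 * suc m ≤ e → 2 * m + 1 ≤ e
    midpoint≤ {m} h = ≤-trans (≤-trans (n≤1+n _) (≤-reflexive (1+[2m+1]≡ m))) h

    -- Preserves `left` and `right` whatever the answers: the new numerator is `2 * m` or
    -- `2 * m + 1`.
    halves-fit : ∀ {m n e} → 2 * suc m ≤ e → n ≤ 2 * m + 1 → 2 * suc n ≤ 2 * e
    halves-fit {m} {n} {e} h n≤ = *-monoʳ-≤ 2 (begin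
      suc n              ≤⟨ s≤s n≤ ⟩
      suc (2 * m + 1)    ≡⟨ 1+[2m+1]≡ m ⟩
      2 * suc m          ≤⟨ h ⟩
      e                  ∎)
      where open ≤-Reasoning

    bodyRun : ∀ {j s} → 0 ℕ.< s 0 → Invariant j s → s 4 * s 0 ℕ.< s 1 →
              ∃[ t ] ∃[ w ] (Run body s t 2 w × Invariant (suc j) t
                             × t 0 ≡ s 0 × t 1 ≡ s 1 × w ≲ 1000)
    bodyRun {j} {s} 0<num inv e*num<den =
      s₅ , _
      , run-⨟ run-query (run-⨟ run-query (run-⨟ run-≔ (run-⨟ run-≔ run-≔)))
      , record
        { scale = cong (2 *_) scale
        ; left  = halves-fit left (+-monoʳ-≤ (2 * s 2) (indicator≤1 b₁))
        ; right = halves-fit right (m∸n≤m (2 * s 3 + 1) r₂)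
        -- As `e` is `2 ^ suc j`, the loop test just passed is the guard for `suc j`.
        ; guard = inj₂ (<⇒≤ (subst (λ e → e * s 0 ℕ.< s 1) scale e*num<den))
        ; sm    = sm₅
        ; room  = room
        ; upper = U-halve (s 2) (s 4) upper
        ; lower = V-halve (s 3) (s 4) lower
        }
      , refl , refl
      -- The weights of the five instructions are closed numerals; their sum is compared with 1000
      -- by computation.
      , raise (≤ᵇ⇒≤ _ 1000 tt)
          ( query≲ 5 ge (midpoint 2) (reg 4) sm mid₂≤B (bits≤ sm 4)
          ⊹ query≲ 6 le (midpoint 3) (reg 4) sm₁ mid₃≤B (bits≤ sm 4)
          ⊹ assign≲ 2 ((lit 2 ⊗ reg 2) ⊕ reg 5) sm₂
          ⊹ assign≲ 3 (midpoint 3 ⊖ reg 6) sm₃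
          ⊹ assign≲ 4 (lit 2 ⊗ reg 4) sm₄ )
      where
      open Invariant inv
      b₁ = ask ge ((2 * s 2 + 1) ÷ s 4)
      b₂ = ask le ((2 * s 3 + 1) ÷ s 4)
      r₁ = indicator b₁
      r₂ = indicator b₂
      s₁ = s [ 5 ↦ r₁ ]
      s₂ = s₁ [ 6 ↦ r₂ ]
      s₃ = s₂ [ 2 ↦ 2 * s 2 + r₁ ]
      s₄ = s₃ [ 3 ↦ 2 * s 3 + 1 ∸ r₂ ]
      s₅ = s₄ [ 4 ↦ 2 * s 4 ]
      mid₂≤B : bits (2 * s 2 + 1) ≤ B
      mid₂≤B = ≤-trans (bits-mono (midpoint≤ left)) (bits≤ sm 4)
      mid₃≤B : bits (2 * s 3 + 1) ≤ B
      mid₃≤B = ≤-trans (bits-mono (midpoint≤ right)) (bits≤ sm 4)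
      sm₁ : Small B s₁
      sm₁ = Small-update 5 (≤-trans (bits-mono (indicator≤1 b₁)) 0<B) sm
      sm₂ : Small B s₂
      sm₂ = Small-update 6 (≤-trans (bits-mono (indicator≤1 b₂)) 0<B) sm₁
      sm₃ : Small B s₃
      sm₃ = Small-update 2
        (≤-trans (bits-mono (+-monoʳ-≤ (2 * s 2) (indicator≤1 b₁))) mid₂≤B) sm₂
      sm₄ : Small B s₄
      sm₄ = Small-update 3 (≤-trans (bits-mono (m∸n≤m (2 * s 3 + 1) r₂)) mid₃≤B) sm₃
      2e≤B : bits (2 * s 4) ≤ B
      2e≤B = begin
        -- Here `e ≤ e * num < den`, the numerator of `ε` being positive.
        bits (2 * s 4)   ≤⟨ bits-mono (*-monoʳ-≤ 2
                              (≤-trans (m≤m*n (s 4) (s 0) {{>-nonZero 0<num}}) (<⇒≤ e*num<den))) ⟩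
        bits (2 * s 1)   ≡⟨ cong suc (⌊log₂[2*b]⌋≡1+⌊log₂b⌋ (s 1)
                              {{>-nonZero (≤-trans (s≤s z≤n) e*num<den)}}) ⟩
        suc (bits (s 1)) ≤⟨ room ⟩
        B                ∎
        where open ≤-Reasoning
      sm₅ : Small B s₅
      sm₅ = Small-update 4 2e≤B sm₄

    iteration≲ : ∀ {s w} → Small B s → w ≲ 1000 → testCost s (reg 4 ⊗ reg 0) (reg 1) + w ≲ c
    iteration≲ sm w≲ = raise (≤-trans (≤ᵇ⇒≤ _ 1100 tt) 1100≤c) (test≲ (reg 4 ⊗ reg 0) (reg 1) sm ⊹ w≲)

    LoopResult : (f j : ℕ) → Store → Set ℓ
    LoopResult f j s =
      ∃[ k ] ∃[ t ] ∃[ w ] (Run loop s t (k * 2) w × Invariant (k + j) t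
        × t 0 ≡ s 0 × t 1 ≡ s 1 × t 1 ≤ t 4 * t 0 × w ≲ suc f * c)

    -- `f` is fuel: `e = 2 ^ suc j` doubles in each iteration, and once it reaches the denominator
    -- of `ε` the test fails. The fuel bounds the work, with one extra `c` for the final test; the
    -- number of queries is controlled by `guard`.
    loopRun : ∀ f {j s} → 0 ℕ.< s 0 → Invariant j s → s 1 ≤ 2 ^ (f + suc j) → LoopResult f j s
    loopRun f {j} {s} 0<num inv den≤ = go f (s 4 * s 0 <? s 1) den≤
      where
      open Invariant inv
      go : ∀ f → Dec (s 4 * s 0 ℕ.< s 1) → s 1 ≤ 2 ^ (f + suc j) → LoopResult f j s
      go f (no e*num≮den) _ =
          0 , s , _ , run-done e*num≮den , inv , refl , refl , ≮⇒≥ e*num≮den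
        , raise (m≤m+n c (f * c))
            ⌞ ≤-trans (m≤m+n _ 0) (_≲_.bound (iteration≲ sm ⌞ z≤n ⌟)) ⌟
      go zero (yes e*num<den) den≤ = contradiction
        (≤-trans den≤ (≤-trans (≤-reflexive (sym scale)) (m≤m*n (s 4) (s 0) {{>-nonZero 0<num}})))
        (<⇒≱ e*num<den)
      go (suc f) (yes e*num<den) den≤ =
        let t , w , run , inv′ , t0 , t1 , w≲ = bodyRun 0<num inv e*num<den
            k , u , w′ , runs , inv″ , u0 , u1 , done , w′≲ =
              loopRun f (subst (0 ℕ.<_) (sym t0) 0<num) inv′
                (≤-trans (≤-reflexive t1)
                  (≤-trans den≤ (≤-reflexive (cong (2 ^_) (sym (+-suc f (suc j)))))))
        in suc k , u , _ , run-step e*num<den run runs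
         , subst (λ i → Invariant i u) (+-suc k j) inv″
         , trans u0 t0 , trans u1 t1 , done
         , iteration≲ sm w≲ ⊹ w′≲

    finished : Store → Store
    finished t = (((t [ 0 ↦ 2 * t 2 + 1 ]) [ 1 ↦ t 4 ]) [ 2 ↦ 2 * t 3 + 1 ]) [ 3 ↦ t 4 ]

    FinishResult : Store → Set
    FinishResult t = ∃[ w ] (Run finish t (finished t) 0 w × w ≲ 1100)

    finishRun : ∀ {j t} → Invariant j t → FinishResult t
    finishRun {j} {t} inv =
      _ , run-⨟ run-≔ (run-⨟ run-≔ (run-⨟ run-≔ run-≔))
        , raise (≤ᵇ⇒≤ _ 1100 tt)
            (assign≲ 0 (midpoint 2) sm ⊹ assign≲ 1 (reg 4) sm₁
              ⊹ assign≲ 2 (midpoint 3) sm₂ ⊹ assign≲ 3 (reg 4) sm₃)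
      where
      open Invariant inv
      sm₁ : Small B (t [ 0 ↦ 2 * t 2 + 1 ])
      sm₁ = Small-update 0 (≤-trans (bits-mono (midpoint≤ left)) (bits≤ sm 4)) sm
      sm₂ : Small B ((t [ 0 ↦ 2 * t 2 + 1 ]) [ 1 ↦ t 4 ])
      sm₂ = Small-update 1 (bits≤ sm 4) sm₁
      sm₃ : Small B (((t [ 0 ↦ 2 * t 2 + 1 ]) [ 1 ↦ t 4 ]) [ 2 ↦ 2 * t 3 + 1 ])
      sm₃ = Small-update 2 (≤-trans (bits-mono (midpoint≤ right)) (bits≤ sm 4)) sm₂

    Result : Store → Set ℓ
    Result s =
      ∃[ k ] ∃[ t ] ∃[ w ] ∃[ a ] ∃[ b ] ∃[ e ]
        (Run procedure s t (k * 2) w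
        × (k ≡ 0 ⊎ 2 ^ k * s 0 ≤ s 1)
        × t 0 ≡ 2 * a + 1 × t 1 ≡ e × t 2 ≡ 2 * b + 1 × t 3 ≡ e
        × U a e × V b e × s 1 ≤ e * s 0
        × w ≤ (c + c + c) * B ^ 3)

    procedureRun : ∀ {s} → 0 ℕ.< s 0 → s 2 ≡ 0 → s 3 ≡ 0 →
                   Small B s → suc (bits (s 1)) ≤ B → U 0 2 → V 0 2 → Result s
    procedureRun {s} 0<num s2 s3 sm₀ room₀ u v =
      -- The fuel is one less than the bit length of the denominator, because `e` starts at 2 rather
      -- than 1.
      conclude (loopRun ⌊log₂ s 1 ⌋ 0<num inv₀
        (≤-trans (<⇒≤ (n<2^bits (s 1))) (≤-reflexive (cong (2 ^_) (+-comm 1 ⌊log₂ s 1 ⌋)))))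
      where
      s₀ = s [ 4 ↦ 2 ]
      inv₀ : Invariant 0 s₀
      inv₀ = record
        { scale = refl
        ; left  = ≤-reflexive (cong (λ m → 2 * suc m) s2)
        ; right = ≤-reflexive (cong (λ m → 2 * suc m) s3)
        ; guard = inj₁ refl
        ; sm    = Small-update 4 (≤-trans (s≤s (s≤s z≤n)) room₀) sm₀
        ; room  = room₀
        ; upper = subst (λ m → U m 2) (sym s2) u
        ; lower = subst (λ m → V m 2) (sym s3) v
        }
      w₀ = suc (bits 4 + cost s (lit 2))
      start≲ : w₀ ≲ 1100
      start≲ = raise (≤ᵇ⇒≤ (suc (bits 4) + weight (lit 2)) 1100 tt) (assign≲ 4 (lit 2) sm₀)
      -- Initialisation, loop and output each cost at most `B * c * Q`; for the loop, the bit length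
      -- of the denominator is at most `B`.
      total : ∀ {w₁ w₂ w₃} → w₁ ≲ 1100 → w₂ ≲ bits (s 1) * c → w₃ ≲ 1100 →
              w₁ + (w₂ + w₃) ≤ (c + c + c) * B ^ 3
      total {w₁} {w₂} {w₃} w₁≲ w₂≲ w₃≲ = begin
        w₁ + (w₂ + w₃)                 ≤⟨ _≲_.bound (c≲ w₁≲ ⊹ raise (*-monoˡ-≤ c bits≤B) w₂≲ ⊹ c≲ w₃≲) ⟩
        (B * c + (B * c + B * c)) * Q  ≡⟨ cube B c ⟩
        (c + c + c) * B ^ 3            ∎
        where
        open ≤-Reasoning
        bits≤B : bits (s 1) ≤ B
        bits≤B = ≤-trans (n≤1+n _) room₀
        c≲ : ∀ {w} → w ≲ 1100 → w ≲ B * c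
        c≲ = raise (≤-trans 1100≤c (m≤n*m c B))
        cube : ∀ b c → (b * c + (b * c + b * c)) * (b * b) ≡ (c + c + c) * (b * (b * (b * 1)))
        cube = solve-∀
      conclude : LoopResult ⌊log₂ s 1 ⌋ 0 s₀ → Result s
      conclude (k , t , w , run , inv , t0 , t1 , done , w≲) = go (finishRun inv)
        where
        open Invariant inv
        go : FinishResult t → Result s
        go (w′ , run′ , w′≲) =
            k , finished t , w₀ + (w + w′) , t 2 , t 3 , t 4
          , subst (λ n → Run procedure s (finished t) n (w₀ + (w + w′))) (+-identityʳ (k * 2))
              (run-⨟ run-≔ (run-⨟ run run′))
          , subst₂ (λ num den → k ≡ 0 ⊎ 2 ^ k * num ≤ den) t0 t1
              (subst (λ i → i ≡ 0 ⊎ 2 ^ i * t 0 ≤ t 1) (+-identityʳ k) guard)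
          , refl , refl , refl , refl , upper , lower
          , subst₂ (λ num den → den ≤ t 4 * num) t0 t1 done
          , total {w₀} start≲ w≲ w′≲

-- Extension values

module _ (S : Signature) (em : ExcludedMiddle 0ℓ) where
  open Syntax S
  open Semantics S em
  open Distribution
  open _Satisfies_

  private
    restrict : ∀ {X : Set} (d : Dec X) {w} → 0ᴿ ≤ᴿ w →
               0ᴿ ≤ᴿ (if does d then w else 0ᴿ) × (if does d then w else 0ᴿ) ≤ᴿ w
    restrict (yes _) {w} 0≤w = 0≤w , ≤ᴿ-refl {w}
    restrict (no  _)     0≤w = ≤ᴿ-refl {0ᴿ} , 0≤w

  contribution : (P : Distribution) → Axiom → Fin (m P) → ℝ
  contribution P α i = if does (em {interp P i ⊨ α}) then weight P i else 0ᴿ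

  0≤prob : ∀ P α → 0ᴿ ≤ᴿ prob P α
  0≤prob P α = ∑ᴿ-nonneg {f = contribution P α} λ i →
    proj₁ (restrict (em {interp P i ⊨ α}) {weight P i} (nonneg P i))

  prob≤1 : ∀ P α → prob P α ≤ᴿ 1ᴿ
  prob≤1 P α = ≤ᴿ-trans {prob P α} {∑ᴿ (weight P)} {1ᴿ}
    (∑ᴿ-mono {f = contribution P α} {weight P} λ i →
      proj₂ (restrict (em {interp P i ⊨ α}) {weight P i} (nonneg P i))) (proj₁ (total P))

  module _ (K : KB) (α : Axiom) where

    added : Comparison → ℚ → KB
    added ⋈ v = addConstraint K (singleConstraint α ⋈ v)

    -- Written as _⊨ᵖ_ unfolds on the added constraint; comparing that with 1ℚ ·ᴿ prob P α
    -- instead would make Agda normalise the Cauchy proofs.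
    value : Distribution → ℝ
    value P = foldr₁ _+ᴿ_ (map⁺ (λ (b , β) → b ·ᴿ prob P β) ((1ℚ , α) ∷₁ []))

    value≈prob : ∀ P → value P ≈ᴿ prob P α
    value≈prob P =
        ≤ᴿ-pointwise {value P} {prob P α} (λ n → ℚₚ.≤-reflexive (ℚₚ.*-identityˡ (seq (prob P α) n)))
      , ≤ᴿ-pointwise {prob P α} {value P} (λ n → ℚₚ.≤-reflexive (sym (ℚₚ.*-identityˡ (seq (prob P α) n))))

    satisfies-added : ∀ P ⋈ v → P Satisfies K → P ⊨ᵖ singleConstraint α ⋈ v →
                      P Satisfies added ⋈ v
    satisfies-added P ⋈ v sat h .sat-cbox = sat .sat-cbox
    satisfies-added P ⋈ v sat h .sat-pbox =
      _∷_ {P = P ⊨ᵖ_} {singleConstraint α ⋈ v} {KB.pbox K} h (sat .sat-pbox)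

    satisfies-base : ∀ P ⋈ v → P Satisfies added ⋈ v → P Satisfies K
    satisfies-base P ⋈ v sat .sat-cbox = sat .sat-cbox
    satisfies-base P ⋈ v sat .sat-pbox =
      All.tail {P = P ⊨ᵖ_} {singleConstraint α ⋈ v} {KB.pbox K} (sat .sat-pbox)

    satisfies-constraint : ∀ P ⋈ v → P Satisfies added ⋈ v → P ⊨ᵖ singleConstraint α ⋈ v
    satisfies-constraint P ⋈ v sat =
      All.head {P = P ⊨ᵖ_} {singleConstraint α ⋈ v} {KB.pbox K} (sat .sat-pbox)

    ext : ∀ P → P Satisfies K → ExtensionValue K α (prob P α)
    ext P sat = P , sat , ≤ᴿ-refl {prob P α} , ≤ᴿ-refl {prob P α}

    module _ p̄ (sup : IsSupremum (ExtensionValue K α) p̄) where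

      -- Satisfiability supplies an extension value, which keeps the supremum from lying below 0.
      sup-bracket₀ : Satisfiable K → Bracket 0 2 p̄
      sup-bracket₀ (P , sat) =
          ≤ᴿ-trans {0ᴿ} {prob P α} {p̄} (0≤prob P α) (proj₁ sup (prob P α) (ext P sat))
        , proj₂ sup 1ᴿ λ x (P , _ , x≤ , _) → ≤ᴿ-trans {x} {prob P α} {1ᴿ} x≤ (prob≤1 P α)

      satisfiable⇒≤sup : ∀ {v} → Satisfiable (added ge v) → fromℚ v ≤ᴿ p̄
      satisfiable⇒≤sup {v} (P , sat) =
        ≤ᴿ-trans {fromℚ v} {value P} {p̄} (satisfies-constraint P ge v sat)
          (≤ᴿ-trans {value P} {prob P α} {p̄} (proj₁ (value≈prob P))
            (proj₁ sup (prob P α) (ext P (satisfies-base P ge v sat))))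

      unsatisfiable⇒sup≤ : ∀ {v} → ¬ Satisfiable (added ge v) → p̄ ≤ᴿ fromℚ v
      unsatisfiable⇒sup≤ {v} unsat = proj₂ sup (fromℚ v) λ x (P , sat , x≤ , _) →
        ≤ᴿ-trans {x} {value P} {fromℚ v}
          (≤ᴿ-trans {x} {prob P α} {value P} x≤ (proj₂ (value≈prob P)))
          -- If `v` were at most the value of `P`, then `P` would satisfy the added constraint.
          -- Refuting one inequality yields the opposite one, so `v` is an upper bound.
          (≰ᴿ⇒≥ᴿ {fromℚ v} {value P} λ v≤ → unsat (P , satisfies-added P ge v sat v≤))

      -- The decision is an argument so that splitting on it also computes the `indicator` in the
      -- new numerator.
      sup-halve : ∀ a e (d : Dec (Satisfiable (added ge ((2 * a + 1) ÷ e)))) →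
                  Bracket a e p̄ → Bracket (2 * a + indicator (does d)) (2 * e) p̄
      sup-halve a e (yes sat) br = upper-half a e p̄ br (satisfiable⇒≤sup sat)
      sup-halve a e (no unsat) br =
        subst (λ n → Bracket n (2 * e) p̄) (sym (+-identityʳ (2 * a)))
          (lower-half a e p̄ br (unsatisfiable⇒sup≤ unsat))

    module _ p̲ (inf : IsInfimum (ExtensionValue K α) p̲) where

      inf-bracket₀ : Satisfiable K → Bracket 0 2 p̲
      inf-bracket₀ (P , sat) =
          proj₂ inf 0ᴿ (λ x (P , _ , _ , ≤x) → ≤ᴿ-trans {0ᴿ} {prob P α} {x} (0≤prob P α) ≤x)
        , ≤ᴿ-trans {p̲} {prob P α} {1ᴿ} (proj₁ inf (prob P α) (ext P sat)) (prob≤1 P α)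

      satisfiable⇒inf≤ : ∀ {v} → Satisfiable (added le v) → p̲ ≤ᴿ fromℚ v
      satisfiable⇒inf≤ {v} (P , sat) =
        ≤ᴿ-trans {p̲} {value P} {fromℚ v}
          (≤ᴿ-trans {p̲} {prob P α} {value P}
            (proj₁ inf (prob P α) (ext P (satisfies-base P le v sat)))
            (proj₂ (value≈prob P)))
          (satisfies-constraint P le v sat)

      unsatisfiable⇒≤inf : ∀ {v} → ¬ Satisfiable (added le v) → fromℚ v ≤ᴿ p̲
      unsatisfiable⇒≤inf {v} unsat = proj₂ inf (fromℚ v) λ x (P , sat , _ , ≤x) →
        ≤ᴿ-trans {fromℚ v} {value P} {x}
          (≰ᴿ⇒≥ᴿ {value P} {fromℚ v} λ ≤v → unsat (P , satisfies-added P le v sat ≤v))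
          (≤ᴿ-trans {value P} {prob P α} {x} (proj₁ (value≈prob P)) ≤x)

      inf-halve : ∀ b e (d : Dec (Satisfiable (added le ((2 * b + 1) ÷ e)))) →
                  Bracket b e p̲ → Bracket (2 * b + 1 ∸ indicator (does d)) (2 * e) p̲
      inf-halve b e (yes sat) br =
        subst (λ n → Bracket n (2 * e) p̲) (sym (m+n∸n≡m (2 * b) 1))
          (lower-half b e p̲ br (satisfiable⇒inf≤ sat))
      inf-halve b e (no unsat) br = upper-half b e p̲ br (unsatisfiable⇒≤inf unsat)

-- Query count, input size and correctness

queries≤ : ∀ k ε → k ≡ 0 ⊎ 2 ^ k * ℤ.∣ ↥ ε ∣ ≤ ↧ₙ ε → (k * 2) ≤ 2 ∣log₂ ε ∣
-- Without iterations one of the two disjuncts holds according to whether `ε` is at least or at most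
-- 1.
queries≤ k ε (inj₁ refl) with ≤-total (↧ₙ ε ^ 2) (ℤ.∣ ↥ ε ∣ ^ 2)
... | inj₁ den≤num = inj₁ (≤-trans (≤-reflexive (*-identityˡ (↧ₙ ε ^ 2))) den≤num)
... | inj₂ num≤den = inj₂ (≤-trans (≤-reflexive (*-identityˡ (ℤ.∣ ↥ ε ∣ ^ 2))) num≤den)
queries≤ k ε (inj₂ 2^k*num≤den) = inj₂ (begin
  -- Two queries per iteration: `2 ^ k ≤ 1/ε` is squared.
  2 ^ (k * 2) * num ^ 2    ≡⟨ cong (_* num ^ 2) (^-*-assoc 2 k 2) ⟨
  (2 ^ k) ^ 2 * num ^ 2    ≡⟨ square (2 ^ k) num ⟨
  (2 ^ k * num) ^ 2        ≤⟨ ^-monoˡ-≤ 2 2^k*num≤den ⟩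
  ↧ₙ ε ^ 2                 ∎)
  where
  open ≤-Reasoning
  num = ℤ.∣ ↥ ε ∣
  square : ∀ x y → (x * y) * ((x * y) * 1) ≡ (x * (x * 1)) * (y * (y * 1))
  square = solve-∀

0<⇒0<↥ : ∀ {ε} → 0ℚ < ε → 0 ℕ.< ℤ.∣ ↥ ε ∣
0<⇒0<↥ {ℚ.mkℚ (+ zero)  _ _} (ℚ.*<* (ℤ.+<+ ()))
0<⇒0<↥ {ℚ.mkℚ (+ suc _) _ _} _ = s≤s z≤n
0<⇒0<↥ {ℚ.mkℚ (ℤ.-[1+ _ ]) _ _} _ = s≤s z≤n

module _ (S : Signature) where
  open Syntax S

  -- The 3 is one for the constraint and two for its coefficient `1ℚ`.
  sizeKB-add : ∀ K α ⋈ v → sizeKB (addConstraint K (singleConstraint α ⋈ v))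
                           ≡ (3 + sizeKB K + sizeA α) + sizeℚ v
  sizeKB-add ⟨ C , P ⟩ α ⋈ v =
    rearrange (sum (map sizeItem C)) (sum (map sizeConstraint P)) (sizeA α) (sizeℚ v)
    where
    rearrange : ∀ c p a q → suc (c + (suc ((2 + a + 0) + q) + p)) ≡ (3 + suc (c + p) + a) + q
    rearrange = solve-∀

  module _ (em : ExcludedMiddle 0ℓ) (sat? : Decidable (Semantics.Satisfiable S em))
           (K : KB) (satK : Semantics.Satisfiable S em K) (α : Axiom)
           (ε : ℚ) (0<ε : 0ℚ < ε) where
    open Semantics S em
    open Procedure S em

    private
      B = sizeKB K + sizeA α + sizeℚ ε
      ask : Comparison → ℚ → Bool
      ask ⋈ v = does (sat? (addConstraint K (singleConstraint α ⋈ v)))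
      price : Comparison → ℚ → ℕ
      price ⋈ v = sizeKB (addConstraint K (singleConstraint α ⋈ v))

      -- The supremum and infimum are quantified inside, because the run and its final store must be
      -- fixed before they are given.
      U V : ℕ → ℕ → Set₁
      U a e = ∀ p̄ → IsSupremum (ExtensionValue K α) p̄ → Bracket a e p̄
      V b e = ∀ p̲ → IsInfimum (ExtensionValue K α) p̲ → Bracket b e p̲

      1≤sizeKB : 1 ≤ sizeKB K
      1≤sizeKB = s≤s z≤n

      0<B : 0 ℕ.< B
      0<B = ≤-trans 1≤sizeKB (≤-trans (m≤m+n _ (sizeA α)) (m≤m+n _ (sizeℚ ε)))

      size≤B : sizeKB K + sizeA α ≤ B
      size≤B = m≤m+n _ (sizeℚ ε)

      price≤ : ∀ ⋈ v → price ⋈ v ≤ 4 * B + sizeℚ v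
      price≤ ⋈ v = begin
        price ⋈ v                                ≡⟨ sizeKB-add K α ⋈ v ⟩
        3 + sizeKB K + sizeA α + sizeℚ v         ≤⟨ +-monoˡ-≤ (sizeℚ v) (begin
          3 + (sizeKB K + sizeA α)                 ≤⟨ +-mono-≤ (*-monoʳ-≤ 3 0<B) size≤B ⟩
          3 * B + B                                ≡⟨ +-comm (3 * B) B ⟩
          4 * B                                    ∎) ⟩
        4 * B + sizeℚ v                          ∎
        where open ≤-Reasoning

      small-input : Small B (input ε)
      small-input = small λ where
        0 → ≤-trans (m≤m+n _ (bits (↧ₙ ε))) (m≤n+m (sizeℚ ε) (sizeKB K + sizeA α))
        1 → ≤-trans (m≤n+m (bits (↧ₙ ε)) (bits ℤ.∣ ↥ ε ∣)) (m≤n+m (sizeℚ ε) (sizeKB K + sizeA α))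
        (suc (suc _)) → 0<B

      room : suc (bits (↧ₙ ε)) ≤ B
      -- The spare bit is paid for by `sizeKB K`, which is at least 1.
      room = +-mono-≤ {1} (≤-trans 1≤sizeKB (m≤m+n _ (sizeA α))) (m≤n+m (bits (↧ₙ ε)) (bits ℤ.∣ ↥ ε ∣))

      U-halve : ∀ a e → U a e → U (2 * a + indicator (ask ge ((2 * a + 1) ÷ e))) (2 * e)
      U-halve a e br p̄ sup =
        sup-halve S em K α p̄ sup a e (sat? (added S em K α ge ((2 * a + 1) ÷ e))) (br p̄ sup)

      V-halve : ∀ b e → V b e → V (2 * b + 1 ∸ indicator (ask le ((2 * b + 1) ÷ e))) (2 * e)
      V-halve b e br p̲ inf =
        inf-halve S em K α p̲ inf b e (sat? (added S em K α le ((2 * b + 1) ÷ e))) (br p̲ inf)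

    open Bisection ask price B price≤ U V U-halve V-halve using (procedureRun; Result)

    correct : ∀ c → 1100 ≤ c → Σ[ t ∈ Store ] Σ[ n ∈ ℕ ] Σ[ w ∈ ℕ ]
         (Run sat? K α procedure (input ε) t n w
          × n ≤ 2 ∣log₂ ε ∣
          × w ≤ (c + c + c) * B ^ 3
          × ((p̄ : ℝ) → IsSupremum (ExtensionValue K α) p̄ → Within ε (output-max t) p̄)
          × ((p̲ : ℝ) → IsInfimum (ExtensionValue K α) p̲ → Within ε (output-min t) p̲))
    correct c 1100≤c = go
      (procedureRun 0<B c 1100≤c {input ε} (0<⇒0<↥ 0<ε) refl refl small-input room
        (λ p̄ sup → sup-bracket₀ S em K α p̄ sup satK) (λ p̲ inf → inf-bracket₀ S em K α p̲ inf satK))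
      where
      go : Result 0<B c 1100≤c (input ε) → _
      go (k , t , w , a , b , e , run , few , t0 , t1 , t2 , t3 , upper , lower , fine , w≤) =
          t , k * 2 , w , run , queries≤ k ε few , w≤
        , (λ p̄ sup → subst (λ v → Within ε v p̄) (sym (cong₂ _÷_ t0 t1))
            (midpoint-within a e p̄ 1/e≤ε (upper p̄ sup)))
        , (λ p̲ inf → subst (λ v → Within ε v p̲) (sym (cong₂ _÷_ t2 t3))
            (midpoint-within b e p̲ 1/e≤ε (lower p̲ inf)))
        where
        1/e≤ε = 1÷e≤ {e} 0<ε fine

theorem3 :
  (S : Signature) →
  let open Syntax S in
  Σ[ p ∈ Program ] Σ[ c ∈ ℕ ] Σ[ a ∈ ℕ ] Σ[ k ∈ ℕ ]
    ((em : ExcludedMiddle 0ℓ) →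
     let open Semantics S em
         open Procedure S em in
     (sat? : Decidable Satisfiable) →
     (K : KB) → Satisfiable K → (α : Axiom) → (ε : ℚ) → 0ℚ < ε →
     Σ[ t ∈ Store ] Σ[ n ∈ ℕ ] Σ[ w ∈ ℕ ]
       (Run sat? K α p (input ε) t n w
        × n ≤ c ∣log₂ ε ∣
        × w ≤ a * (sizeKB K + sizeA α + sizeℚ ε) ^ k
        × ((p̄ : ℝ) → IsSupremum (ExtensionValue K α) p̄ → Within ε (output-max t) p̄)
        × ((p̲ : ℝ) → IsInfimum (ExtensionValue K α) p̲ → Within ε (output-min t) p̲)))
theorem3 S =
    -- The 2 counts the queries per iteration, the sum has one term for each stage of the program,
    -- and the exponent is 3 since at most linearly many iterations have quadratic cost.
    procedure , 2 , 1100 + 1100 + 1100 , 3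
  , λ em sat? K satK α ε 0<ε → correct S em sat? K satK α ε 0<ε 1100 ≤-refl
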